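{- Let $V$ be a finite set and let $S$ and $T$ be zero-diagonal symmetric $V\times V$ matrices over $GF(2)$. Then $S\sim_{lc}T$ if and only if $S\sim_{mi}T$.
   Context: All matrices have entries in the two-element field $GF(2)$. A square matrix $S=(s_{ij})$ is symmetric if $s_{ij}=s_{ji}$ for all $i\neq j$, and zero-diagonal if $s_{ii}=0$ for all $i$. Toggling an entry means applying $x\mapsto x+1$ to it. Simple local complement: if $S$ is a symmetric matrix and $i$ is an index, the simple local complement $S^{i}$ of $S$ at $i$ is the symmetric matrix obtained from $S$ by toggling $s_{jk}$ for all $j,k$ such that $i,j,k$ are pairwise distinct and $s_{ij}\neq 0\neq s_{ik}$. (All other entries, in particular all diagonal entries, are unchanged.) For zero-diagonal symmetric matrices, $S\sim_{lc}T$ means that $T$ can be obtained from $S$ through a finite (possibly empty) sequence of simple local complementations. Modified inverse: if $S$ is a zero-diagonal symmetric matrix, a modified inverse of $S$ is a zero-diagonal symmetric matrix obtained as follows: first toggle some (possibly no) diagonal entries of $S$ to obtain an invertible symmetric matrix $S'$, and then toggle every nonzero diagonal entry of $(S')^{ -1}$. For zero-diagonal symmetric matrices, $S\sim_{mi}T$ means that $T$ can be obtained from $S$ through a finite (possibly empty) sequence of modified inversions (i.e. each matrix in the sequence is a modified inverse of the preceding one). -}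

module Defs where

open import Algebra.Bundles using (CommutativeRing)
open import Data.Bool.Base using (Bool; if_then_else_)
import Data.Bool.Properties as Bool
open import Data.Fin.Base using (Fin)
import Data.Fin.Properties as Fin
open import Data.Nat.Base using (ℕ)
open import Data.Product.Base using (_×_; ∃-syntax)
open import Function.Bundles using (_↔_; module Inverse)
open import Function.Properties.Inverse using (↔⇒↣)
open import Level using (Level)
open import Relation.Binary.Construct.Closure.ReflexiveTransitive using (Star)
open import Relation.Binary.Definitions using (DecidableEquality)
open import Relation.Binary.PropositionalEquality.Core using (_≡_; _≢_)
open import Relation.Nullary.Decidable.Core using (Dec; does; ¬?; _×-dec_)
open import Relation.Nullary.Decidable using (via-injection)

-- GF(2) is Bool with _xor_ as addition and _∧_ as multiplication.
module GF2 = CommutativeRing Bool.xor-∧-commutativeRing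
open GF2 using (_+_; _*_; 0#; 1#)

import Algebra.Properties.Monoid.Sum GF2.+-monoid as Sum

toggle : Bool → Bool
toggle x = x + 1#

module _ {ℓ : Level} where

  Matrix : Set ℓ → Set ℓ
  Matrix V = V → V → Bool

  -- Function extensionality is unavailable, so matrices are compared entrywise.
  infix 4 _≐_
  _≐_ : {V : Set ℓ} → Matrix V → Matrix V → Set ℓ
  A ≐ B = ∀ i j → A i j ≡ B i j

  IsSymmetric : {V : Set ℓ} → Matrix V → Set ℓ
  IsSymmetric A = ∀ i j → A i j ≡ A j i

  IsZeroDiagonal : {V : Set ℓ} → Matrix V → Set ℓ
  IsZeroDiagonal A = ∀ i → A i i ≡ 0#

  record ZeroDiagonalSymmetric (V : Set ℓ) : Set ℓ where
    field
      matrix       : Matrix V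
      symmetric    : IsSymmetric matrix
      zeroDiagonal : IsZeroDiagonal matrix

open ZeroDiagonalSymmetric public using (matrix)

-- A finite set is a type V together with an enumeration of its elements.
-- The enumeration is used only to compare indices and to sum over V.
module _ {ℓ : Level} {V : Set ℓ} {n : ℕ} (V↔Fin : V ↔ Fin n) where

  _≟_ : DecidableEquality V
  _≟_ = via-injection (↔⇒↣ V↔Fin) Fin._≟_

  ∑ : (V → Bool) → Bool
  ∑ f = Sum.sum (λ k → f (Inverse.from V↔Fin k))

  identity : Matrix V
  identity i j = if does (i ≟ j) then 1# else 0#

  product : Matrix V → Matrix V → Matrix V
  product A B i j = ∑ (λ k → A i k * B k j)

  IsInverse : Matrix V → Matrix V → Set ℓ
  IsInverse A B = product A B ≐ identity × product B A ≐ identity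

  complements? : (S : Matrix V) (i j k : V) →
    Dec (i ≢ j × i ≢ k × j ≢ k × S i j ≢ 0# × S i k ≢ 0#)
  complements? S i j k =
    ¬? (i ≟ j) ×-dec ¬? (i ≟ k) ×-dec ¬? (j ≟ k) ×-dec
    ¬? (S i j Bool.≟ 0#) ×-dec ¬? (S i k Bool.≟ 0#)

  localComplement : Matrix V → V → Matrix V
  localComplement S i j k =
    if does (complements? S i j k) then toggle (S j k) else S j k

  -- D is the characteristic function of the set of indices to be toggled.
  toggleDiagonal : (D : V → Bool) → Matrix V → Matrix V
  toggleDiagonal D A i j =
    if does (i ≟ j) then (if D i then toggle (A i j) else A i j) else A i j

  -- Over GF(2) the diagonal is itself the characteristic function of the set
  -- of indices whose diagonal entry is nonzero.
  toggleNonzeroDiagonal : Matrix V → Matrix V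
  toggleNonzeroDiagonal A = toggleDiagonal (λ i → A i i) A

  IsLocalComplement : (S T : ZeroDiagonalSymmetric V) → Set ℓ
  IsLocalComplement S T = ∃[ i ] matrix T ≐ localComplement (matrix S) i

  IsModifiedInverse : (S T : ZeroDiagonalSymmetric V) → Set ℓ
  IsModifiedInverse S T =
    ∃[ D ] ∃[ B ] IsInverse (toggleDiagonal D (matrix S)) B
                × matrix T ≐ toggleNonzeroDiagonal B

  -- Star ends at the given endpoint up to _≡_; the final _≐_ makes the empty
  -- sequence relate entrywise equal matrices.
  LCEquivalent : (S T : ZeroDiagonalSymmetric V) → Set ℓ
  LCEquivalent S T =
    ∃[ U ] Star IsLocalComplement S U × matrix U ≐ matrix T

  MIEquivalent : (S T : ZeroDiagonalSymmetric V) → Set ℓ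
  MIEquivalent S T =
    ∃[ U ] Star IsModifiedInverse S U × matrix U ≐ matrix T

{-# OPTIONS --safe #-}
module Submission where

-- Write c for the row of S at u.  Since S has zero diagonal, c u = 0, and the
-- local complement S ⋆ u satisfies
--
--   (S ⋆ u) + diag c  =  S + c cᵀ.
--
-- Attach a diagonal d to S and view S + diag d as its graph, the space of pairs
-- (x , y) with y = S x + d x.  For a set X of indices, the pairs (S , d) and
-- (T , e) are X-exchanged when swapping x and y in the coordinates of X carries
-- the graph of (S , d) into the graph of (T , e) (a principal pivot transform).
-- When X is everything, this says that (T + diag e)(S + diag d) = 1; as both
-- factors are symmetric they are then mutually inverse, so T is a modified
-- inverse of S exactly when (S , d) and (T , e) are exchanged at every index for
-- some d and e.  When X is empty, S and T are equal.
--
-- By the rank-one formula, local complementation at u acts on such exchanges,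
-- with d replaced by d + c:
--   * if d u = 1, then X is toggled at u (lemma pivot);
--   * if d u = 0 and u lies in X, then X stays and e is toggled at u (lemma shear).
-- Moreover d and e may be toggled together at an index outside X (lemma
-- toggleOutside).
--
-- From modified inverses to local complements: start with X everything and
-- shrink X by local complementations.  If some v in X has d v = 1, pivot at v.
-- Otherwise d vanishes on X; then each v in X has a neighbour u in X (lemma
-- exchange-neighbour), and shearing at u makes d v = 1, after which v can be
-- pivoted out.
--
-- From local complements to modified inverses: S ⋆ i = S if i is isolated.
-- Otherwise there are U and d such that U is exchanged with S at every index
-- for some e with e i = 0.  To find them, begin with the trivial exchange of S
-- with itself, pivot at a neighbour j of i and then at i, and go on pivoting
-- (toggling outside X where necessary) until X is everything.  The pivot at j
-- sets d i = 1, hence e i is never toggled.  Exchanging the roles of the two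
-- matrices and shearing at i shows that U is exchanged both with S and with
-- S ⋆ i, so S, U, S ⋆ i is a sequence of modified inverses.

open import Defs
open import Data.Bool.Base using (Bool; true; false; not; if_then_else_)
import Data.Bool.Properties as Bool
open import Data.Bool.Solver using (module xor-∧-Solver)
open import Data.Fin.Base using (Fin; punchIn)
import Data.Fin.Properties as Fin
open import Data.Fin.Subset using (Subset; _⊂_)
open import Data.Fin.Subset.Induction using (⊂-wellFounded)
open import Data.Nat.Base using (ℕ; suc)
open import Data.Product.Base using (_×_; _,_; ∃-syntax; proj₁)
open import Data.Sum.Base using (_⊎_; inj₁; inj₂)
open import Data.Vec.Base using (tabulate; lookup)
open import Data.Vec.Properties using (lookup∘tabulate; lookup⇒[]=; []=⇒lookup)
open import Function.Base using (_∘_; _on_; const)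
open import Function.Bundles using (_↔_; _⇔_; mk⇔; module Inverse)
open import Induction.WellFounded using (Acc; acc; WellFounded)
open import Level using (Level)
open import Relation.Binary.Construct.Closure.ReflexiveTransitive using (Star; ε; _◅_; _◅◅_)
import Relation.Binary.Construct.On as On
open import Relation.Binary.Core using (Rel)
open import Relation.Binary.PropositionalEquality
  using (_≡_; _≢_; _≗_; refl; sym; trans; cong; cong₂; subst; module ≡-Reasoning)
open import Relation.Nullary using (yes; no; contradiction)
open import Relation.Nullary.Decidable using (dec-true; dec-false)

open GF2 using (_+_; _*_; 0#; 1#)
import Algebra.Properties.Semiring.Sum GF2.semiring as Sum
open xor-∧-Solver using (solve; _:=_; _:+_; _:*_; con)
open ≡-Reasoning

-- Scalars and finite sums over GF(2)

0≢1 : ∀ {b} → b ≡ 0# → b ≢ 1#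
0≢1 refl ()

*≡1⇒ˡ : ∀ {a b} → a * b ≡ 1# → a ≡ 1#
*≡1⇒ˡ {true} p = refl

*≡1⇒ʳ : ∀ {a b} → a * b ≡ 1# → b ≡ 1#
*≡1⇒ʳ {true} p = p

-- The ring solver does not use idempotence, so this identity is proved by cases.
*-idem-cancel : ∀ s a → s ≡ s + a * a + a * 1#
*-idem-cancel false false = refl
*-idem-cancel false true  = refl
*-idem-cancel true  false = refl
*-idem-cancel true  true  = refl

+-*-zero : ∀ a s {e} → e ≡ 0# → a + s * e ≡ a
+-*-zero a s refl = trans (cong (a +_) (GF2.zeroʳ s)) (GF2.+-identityʳ a)

+-cancel : ∀ a b → a ≡ a + b + b
+-cancel a b = solve 2 (λ a b → a := a :+ b :+ b) refl a b

-- Conditionals describe the coordinates of a pair after a partial swap.  In the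
-- next lemmas b says whether a coordinate is swapped, and e whether a multiple of
-- a unit vector contributes to it.

if-addˡ : ∀ b {f g} s {e} → b ≡ 0# ⊎ e ≡ 0# → (if b then f + s * e else g) ≡ (if b then f else g)
if-addˡ false s _           = refl
if-addˡ true  s (inj₂ e≡0) = +-*-zero _ s e≡0

if-addʳ : ∀ b {f g} s {e} → b ≡ 1# ⊎ e ≡ 0# → (if b then f else g + s * e) ≡ (if b then f else g)
if-addʳ true  s _           = refl
if-addʳ false s (inj₂ e≡0) = +-*-zero _ s e≡0

if-add-cancelˡ : ∀ b {f g} s {e} → b ≡ 1# ⊎ e ≡ 0# →
  (if b then f else g) ≡ (if b then f + s * e else g) + s * e
if-add-cancelˡ true  s _           = +-cancel _ _
if-add-cancelˡ false s (inj₂ e≡0) = sym (+-*-zero _ s e≡0)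

if-add-cancelʳ : ∀ b {f g} s {e} → b ≡ 0# ⊎ e ≡ 0# →
  (if b then f else g) ≡ (if b then f else g + s * e) + s * e
if-add-cancelʳ false s _           = +-cancel _ _
if-add-cancelʳ true  s (inj₂ e≡0) = sym (+-*-zero _ s e≡0)

if-toggle : ∀ b {f g} s {e} → e ≡ 0# ⊎ (e ≡ 1# × f ≡ s + g) →
  (if b then f + s * e else g + s * e) ≡ (if b + e then f else g)
if-toggle false s (inj₁ refl) = +-*-zero _ s refl
if-toggle true  s (inj₁ refl) = +-*-zero _ s refl
if-toggle false {g = g} s (inj₂ (refl , refl)) = solve 2 (λ g s → g :+ s :* con 1# := s :+ g) refl g s
if-toggle true  {g = g} s (inj₂ (refl , refl)) = solve 2 (λ g s → s :+ g :+ s :* con 1# := g) refl g s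

sum-zero : ∀ {n} (f : Fin n → Bool) → (∀ k → f k ≡ 0#) → Sum.sum f ≡ 0#
sum-zero {n} f f≡0 = trans (Sum.sum-cong-≗ f≡0) (Sum.sum-replicate-zero n)

sum-single : ∀ {n} (f : Fin n → Bool) (j : Fin n) →
  (∀ k → k ≢ j → f k ≡ 0#) → Sum.sum f ≡ f j
sum-single {suc n} f j f≡0 = begin
  Sum.sum f                               ≡⟨ Sum.sum-remove {i = j} f ⟩
  f j + Sum.sum (λ k → f (punchIn j k))   ≡⟨ cong (f j +_) (sum-zero _ λ k → f≡0 _ (Fin.punchInᵢ≢i j k)) ⟩
  f j + 0#                                ≡⟨ GF2.+-identityʳ (f j) ⟩
  f j                                     ∎

-- Sequences of steps, up to entrywise equality

module _ {ℓ : Level} {V : Set ℓ} where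

  -- T is reached, up to entrywise equality, by a finite sequence of R-steps from S.
  -- The relations LCEquivalent and MIEquivalent are instances of this.
  Reachable : Rel (ZeroDiagonalSymmetric V) ℓ → Rel (ZeroDiagonalSymmetric V) ℓ
  Reachable R S T = ∃[ U ] Star R S U × matrix U ≐ matrix T

  -- The source of an R-step may be replaced by an entrywise equal matrix.  This is
  -- what allows sequences that meet only up to entrywise equality to be joined.
  RespectsLeft : Rel (ZeroDiagonalSymmetric V) ℓ → Set ℓ
  RespectsLeft R = ∀ S S′ T → matrix S′ ≐ matrix S → R S T → R S′ T

  ≐-trans : {A B C : Matrix V} → A ≐ B → B ≐ C → A ≐ C
  ≐-trans p q i j = trans (p i j) (q i j)

  reachable-trans : ∀ (R : Rel (ZeroDiagonalSymmetric V) ℓ) → RespectsLeft R →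
    ∀ S T U → Reachable R S T → Reachable R T U → Reachable R S U
  reachable-trans R resp S T U (S′ , p , S′≐T) (_ , ε , T≐U) = S′ , p , ≐-trans S′≐T T≐U
  reachable-trans R resp S T U (S′ , p , S′≐T) (W , _◅_ {j = T′} r q , W≐U) =
    W , p ◅◅ (resp T S′ T′ S′≐T r ◅ q) , W≐U

  reachable-map : ∀ (Q R : Rel (ZeroDiagonalSymmetric V) ℓ) → RespectsLeft R →
    (∀ S T → Q S T → Reachable R S T) →
    ∀ S T → Reachable Q S T → Reachable R S T
  reachable-map Q R resp f S T (_ , ε , S≐T) = _ , ε , S≐T
  reachable-map Q R resp f S T (U , _◅_ {j = S′} q qs , U≐T) =
    reachable-trans R resp S S′ T (f S S′ q) (reachable-map Q R resp f S′ T (U , qs , U≐T))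

module _ {ℓ : Level} {V : Set ℓ} {n : ℕ} (V↔Fin : V ↔ Fin n) where

  open Inverse V↔Fin using (to; from; strictlyInverseˡ; strictlyInverseʳ)
  open ZeroDiagonalSymmetric using (symmetric; zeroDiagonal)

  private
    _≟ⱽ_ = _≟_ V↔Fin

    Σⱽ : (V → Bool) → Bool
    Σⱽ = ∑ V↔Fin

    δ : Matrix V
    δ = identity V↔Fin

  -- Summation over V and the identity matrix

  ∑-cong : ∀ {f g} → f ≗ g → Σⱽ f ≡ Σⱽ g
  ∑-cong p = Sum.sum-cong-≗ (λ k → p (from k))

  ∑-+ : ∀ f g → Σⱽ (λ k → f k + g k) ≡ Σⱽ f + Σⱽ g
  ∑-+ f g = Sum.∑-distrib-+ (f ∘ from) (g ∘ from)

  *-∑ : ∀ c f → Σⱽ (λ k → c * f k) ≡ c * Σⱽ f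
  *-∑ c f = sym (Sum.*-distribˡ-sum c (f ∘ from))

  ∑-comm : ∀ (f : Matrix V) → Σⱽ (λ i → Σⱽ (f i)) ≡ Σⱽ (λ j → Σⱽ (λ i → f i j))
  ∑-comm f = Sum.∑-comm (λ i j → f (from i) (from j))

  -- Comparison of indices reduces to comparison of their images in Fin n, so case
  -- distinctions that are to reduce a conditional are made on the latter.
  to-injective : ∀ {i j} → to i ≡ to j → i ≡ j
  to-injective {i} {j} p = trans (sym (strictlyInverseʳ i)) (trans (cong from p) (strictlyInverseʳ j))

  δ-diagonal : ∀ i → δ i i ≡ 1#
  δ-diagonal i = cong (if_then 1# else 0#) (dec-true (i ≟ⱽ i) refl)

  δ-offDiagonal : ∀ {i j} → i ≢ j → δ i j ≡ 0#
  δ-offDiagonal {i} {j} i≢j = cong (if_then 1# else 0#) (dec-false (i ≟ⱽ j) i≢j)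

  δ-comm : ∀ i j → δ i j ≡ δ j i
  δ-comm i j with i ≟ⱽ j
  ... | yes refl = refl
  ... | no i≢j   = trans (δ-offDiagonal i≢j) (sym (δ-offDiagonal (i≢j ∘ sym)))

  equal-or-δ≡0 : ∀ i j → i ≡ j ⊎ δ i j ≡ 0#
  equal-or-δ≡0 i j with i ≟ⱽ j
  ... | yes i≡j = inj₁ i≡j
  ... | no i≢j  = inj₂ (δ-offDiagonal i≢j)

  δ-transport : ∀ (f : V → Bool) i j → f i * δ i j ≡ f j * δ i j
  δ-transport f i j with equal-or-δ≡0 i j
  ... | inj₁ refl  = refl
  ... | inj₂ δij≡0 = trans (trans (cong (f i *_) δij≡0) (GF2.zeroʳ (f i)))
                           (sym (trans (cong (f j *_) δij≡0) (GF2.zeroʳ (f j))))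

  value-or-δ≡0 : ∀ (f : V → Bool) {i b} → f i ≡ b → ∀ j → f j ≡ b ⊎ δ i j ≡ 0#
  value-or-δ≡0 f {i} fi≡b j with equal-or-δ≡0 i j
  ... | inj₁ refl  = inj₁ fi≡b
  ... | inj₂ δij≡0 = inj₂ δij≡0

  ∑-δ : ∀ i (f : V → Bool) → Σⱽ (λ k → δ i k * f k) ≡ f i
  ∑-δ i f = begin
    Σⱽ (λ k → δ i k * f k)                ≡⟨ sum-single _ (to i) (λ k k≢ → cong (_* f (from k)) (δ-offDiagonal {i} (elsewhere k≢))) ⟩
    δ i (from (to i)) * f (from (to i))   ≡⟨ cong (λ j → δ i j * f j) (strictlyInverseʳ i) ⟩
    δ i i * f i                           ≡⟨ cong (_* f i) (δ-diagonal i) ⟩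
    f i                                   ∎
    where
    elsewhere : ∀ {k} → k ≢ to i → i ≢ from k
    elsewhere {k} k≢ refl = k≢ (sym (strictlyInverseˡ k))

  -- A Boolean predicate on V either holds somewhere or fails everywhere.
  search : ∀ (f : V → Bool) → (∃[ v ] f v ≡ 1#) ⊎ (∀ v → f v ≡ 0#)
  search f with Fin.any? (λ k → f (from k) Bool.≟ 1#)
  ... | yes (k , p) = inj₁ (from k , p)
  ... | no ¬p       = inj₂ λ v → Bool.¬-not (λ fv≡1 →
          ¬p (to v , trans (cong f (strictlyInverseʳ v)) fv≡1))

  -- Matrices acting on vectors

  -- The matrix-vector product.
  apply : Matrix V → (V → Bool) → (V → Bool)
  apply A x i = Σⱽ (λ k → A i k * x k)

  apply-cong : ∀ A {x y} → x ≗ y → apply A x ≗ apply A y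
  apply-cong A x≗y i = ∑-cong (λ k → cong (A i k *_) (x≗y k))

  -- Row j of the identity matrix serves as the j-th unit vector.
  apply-δ : ∀ A j → apply A (δ j) ≗ λ i → A i j
  apply-δ A j i = trans (∑-cong (λ k → GF2.*-comm (A i k) (δ j k))) (∑-δ j (A i))

  apply-product : ∀ A B x → apply A (apply B x) ≗ apply (product V↔Fin A B) x
  apply-product A B x i = begin
    Σⱽ (λ k → A i k * Σⱽ (λ l → B k l * x l))
      ≡⟨ ∑-cong (λ k → sym (*-∑ (A i k) (λ l → B k l * x l))) ⟩
    Σⱽ (λ k → Σⱽ (λ l → A i k * (B k l * x l)))
      ≡⟨ ∑-comm (λ k l → A i k * (B k l * x l)) ⟩
    Σⱽ (λ l → Σⱽ (λ k → A i k * (B k l * x l)))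
      ≡⟨ ∑-cong (λ l → ∑-cong (λ k →
           solve 3 (λ a b c → a :* (b :* c) := c :* (a :* b)) refl (A i k) (B k l) (x l))) ⟩
    Σⱽ (λ l → Σⱽ (λ k → x l * (A i k * B k l)))
      ≡⟨ ∑-cong (λ l → *-∑ (x l) (λ k → A i k * B k l)) ⟩
    Σⱽ (λ l → x l * product V↔Fin A B i l)
      ≡⟨ ∑-cong (λ l → GF2.*-comm (x l) (product V↔Fin A B i l)) ⟩
    apply (product V↔Fin A B) x i ∎

  apply-addAt : ∀ A x c u → apply A (λ k → x k + c * δ u k) ≗ λ i → apply A x i + A i u * c
  apply-addAt A x c u i = begin
    Σⱽ (λ k → A i k * (x k + c * δ u k))
      ≡⟨ ∑-cong (λ k → solve 4 (λ a x c d → a :* (x :+ c :* d) := a :* x :+ d :* (a :* c)) refl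
           (A i k) (x k) c (δ u k)) ⟩
    Σⱽ (λ k → A i k * x k + δ u k * (A i k * c))
      ≡⟨ ∑-+ (λ k → A i k * x k) (λ k → δ u k * (A i k * c)) ⟩
    apply A x i + Σⱽ (λ k → δ u k * (A i k * c))
      ≡⟨ cong (apply A x i +_) (∑-δ u (λ k → A i k * c)) ⟩
    apply A x i + A i u * c ∎

  toggleDiagonal-δ : ∀ d A i j → toggleDiagonal V↔Fin d A i j ≡ A i j + d i * δ i j
  toggleDiagonal-δ d A i j with to i Fin.≟ to j | d i
  ... | yes _ | true  = refl
  ... | yes _ | false = sym (GF2.+-identityʳ (A i j))
  ... | no _  | true  = sym (GF2.+-identityʳ (A i j))
  ... | no _  | false = sym (GF2.+-identityʳ (A i j))

  toggleDiagonal-cong : ∀ d A B → A ≐ B → toggleDiagonal V↔Fin d A ≐ toggleDiagonal V↔Fin d B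
  toggleDiagonal-cong d A B A≐B i j = begin
    toggleDiagonal V↔Fin d A i j   ≡⟨ toggleDiagonal-δ d A i j ⟩
    A i j + d i * δ i j            ≡⟨ cong (_+ d i * δ i j) (A≐B i j) ⟩
    B i j + d i * δ i j            ≡⟨ toggleDiagonal-δ d B i j ⟨
    toggleDiagonal V↔Fin d B i j   ∎

  toggleDiagonal-symmetric : ∀ d {A} → IsSymmetric A → IsSymmetric (toggleDiagonal V↔Fin d A)
  toggleDiagonal-symmetric d {A} A-sym i j = begin
    toggleDiagonal V↔Fin d A i j   ≡⟨ toggleDiagonal-δ d A i j ⟩
    A i j + d i * δ i j            ≡⟨ cong₂ _+_ (A-sym i j)
                                            (trans (δ-transport d i j) (cong (d j *_) (δ-comm i j))) ⟩
    A j i + d j * δ j i            ≡⟨ toggleDiagonal-δ d A j i ⟨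
    toggleDiagonal V↔Fin d A j i   ∎

  apply-toggleDiagonal : ∀ d A x →
    apply (toggleDiagonal V↔Fin d A) x ≗ λ i → apply A x i + d i * x i
  apply-toggleDiagonal d A x i = begin
    Σⱽ (λ k → toggleDiagonal V↔Fin d A i k * x k)
      ≡⟨ ∑-cong (λ k → cong (_* x k) (toggleDiagonal-δ d A i k)) ⟩
    Σⱽ (λ k → (A i k + d i * δ i k) * x k)
      ≡⟨ ∑-cong (λ k → solve 4 (λ a d e x → (a :+ d :* e) :* x := a :* x :+ e :* (d :* x)) refl
           (A i k) (d i) (δ i k) (x k)) ⟩
    Σⱽ (λ k → A i k * x k + δ i k * (d i * x k))
      ≡⟨ ∑-+ (λ k → A i k * x k) (λ k → δ i k * (d i * x k)) ⟩
    apply A x i + Σⱽ (λ k → δ i k * (d i * x k))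
      ≡⟨ cong (apply A x i +_) (∑-δ i (λ k → d i * x k)) ⟩
    apply A x i + d i * x i ∎

  product-cong : ∀ A A′ B B′ → A ≐ A′ → B ≐ B′ → product V↔Fin A B ≐ product V↔Fin A′ B′
  product-cong A A′ B B′ p q i j = ∑-cong (λ k → cong₂ _*_ (p i k) (q k j))

  -- Local complements

  -- Off the diagonal, S ⋆ u is S + c cᵀ where c is row u of S; the last term
  -- cancels the diagonal of c cᵀ.
  localComplement-rankOne : ∀ (S : ZeroDiagonalSymmetric V) u j k →
    localComplement V↔Fin (matrix S) u j k
      ≡ matrix S j k + matrix S u j * matrix S u k + matrix S u j * δ j k
  localComplement-rankOne S u j k with to u Fin.≟ to j | to u Fin.≟ to k | to j Fin.≟ to k
  ... | yes p | _ | _ with refl ← to-injective p rewrite zeroDiagonal S u =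
        solve 1 (λ s → s := s :+ con 0# :+ con 0#) refl (matrix S u k)
  ... | no _ | yes p | yes q with refl ← to-injective p with refl ← to-injective q
        rewrite zeroDiagonal S u = refl
  ... | no _ | yes p | no _ with refl ← to-injective p rewrite zeroDiagonal S u =
        solve 2 (λ s a → s := s :+ a :* con 0# :+ a :* con 0#) refl (matrix S j u) (matrix S u j)
  ... | no _ | no _ | yes q with refl ← to-injective q =
        *-idem-cancel (matrix S j j) (matrix S u j)
  ... | no _ | no _ | no _ with matrix S u j | matrix S u k
  ...   | false | _     = solve 1 (λ s → s := s :+ con 0# :+ con 0#) refl (matrix S j k)
  ...   | true  | false = solve 1 (λ s → s := s :+ con 0# :+ con 0#) refl (matrix S j k)
  ...   | true  | true  = solve 1 (λ s → s :+ con 1# := s :+ con 1# :+ con 0#) refl (matrix S j k)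

  localComplement-cong : ∀ {S T : ZeroDiagonalSymmetric V} → matrix S ≐ matrix T → ∀ u →
    localComplement V↔Fin (matrix S) u ≐ localComplement V↔Fin (matrix T) u
  localComplement-cong {S} {T} S≐T u j k
    rewrite localComplement-rankOne S u j k | localComplement-rankOne T u j k
          | S≐T j k | S≐T u j | S≐T u k = refl

  -- The local complement of S at u, bundled as a zero-diagonal symmetric matrix.
  infixl 8 _⋆_
  _⋆_ : ZeroDiagonalSymmetric V → V → ZeroDiagonalSymmetric V
  S ⋆ u = record
    { matrix       = localComplement V↔Fin (matrix S) u
    ; symmetric    = λ j k → begin
        localComplement V↔Fin (matrix S) u j k
          ≡⟨ localComplement-rankOne S u j k ⟩
        matrix S j k + matrix S u j * matrix S u k + matrix S u j * δ j k
          ≡⟨ cong₂ _+_ (cong₂ _+_ (symmetric S j k) (GF2.*-comm (matrix S u j) (matrix S u k)))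
                       (trans (δ-transport (matrix S u) j k) (cong (matrix S u k *_) (δ-comm j k))) ⟩
        matrix S k j + matrix S u k * matrix S u j + matrix S u k * δ k j
          ≡⟨ localComplement-rankOne S u k j ⟨
        localComplement V↔Fin (matrix S) u k j ∎
    ; zeroDiagonal = λ j → begin
        localComplement V↔Fin (matrix S) u j j
          ≡⟨ localComplement-rankOne S u j j ⟩
        matrix S j j + matrix S u j * matrix S u j + matrix S u j * δ j j
          ≡⟨ cong₂ (λ s e → s + matrix S u j * matrix S u j + matrix S u j * e)
                   (zeroDiagonal S j) (δ-diagonal j) ⟩
        matrix S u j * matrix S u j + matrix S u j * 1#
          ≡⟨ sym (*-idem-cancel 0# (matrix S u j)) ⟩
        0# ∎
    }

  apply-localComplement : ∀ S u x i →
    apply (matrix (S ⋆ u)) x i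
      ≡ apply (matrix S) x i + matrix S u i * apply (matrix S) x u + matrix S u i * x i
  apply-localComplement S u x i = begin
    Σⱽ (λ k → matrix (S ⋆ u) i k * x k)
      ≡⟨ ∑-cong (λ k → cong (_* x k) (localComplement-rankOne S u i k)) ⟩
    Σⱽ (λ k → (matrix S i k + c i * c k + c i * δ i k) * x k)
      ≡⟨ ∑-cong (λ k → solve 5 (λ s a b e x → (s :+ a :* b :+ a :* e) :* x
           := s :* x :+ a :* (b :* x) :+ e :* (a :* x)) refl (matrix S i k) (c i) (c k) (δ i k) (x k)) ⟩
    Σⱽ (λ k → matrix S i k * x k + c i * (c k * x k) + δ i k * (c i * x k))
      ≡⟨ ∑-+ (λ k → matrix S i k * x k + c i * (c k * x k)) (λ k → δ i k * (c i * x k)) ⟩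
    Σⱽ (λ k → matrix S i k * x k + c i * (c k * x k)) + Σⱽ (λ k → δ i k * (c i * x k))
      ≡⟨ cong₂ _+_ (∑-+ (λ k → matrix S i k * x k) (λ k → c i * (c k * x k)))
                   (∑-δ i (λ k → c i * x k)) ⟩
    apply (matrix S) x i + Σⱽ (λ k → c i * (c k * x k)) + c i * x i
      ≡⟨ cong (λ r → apply (matrix S) x i + r + c i * x i) (*-∑ (c i) (λ k → c k * x k)) ⟩
    apply (matrix S) x i + c i * apply (matrix S) x u + c i * x i ∎
    where
    c = matrix S u

  -- Exchanges

  -- (x , y) lies on the graph of the symmetric matrix S + diag d.
  Graph : Matrix V → (d x y : V → Bool) → Set ℓ
  Graph S d x y = ∀ i → y i ≡ apply S x i + d i * x i

  -- f on X and g elsewhere.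
  select : (X f g : V → Bool) → V → Bool
  select X f g i = if X i then f i else g i

  -- Swapping x and y in the coordinates of X maps the graph of S + diag d into the
  -- graph of T + diag e.  Both spaces have the same dimension, so inclusion is
  -- enough.
  record Exchanges (X : V → Bool) (S : Matrix V) (d : V → Bool)
                   (T : Matrix V) (e : V → Bool) : Set ℓ where
    constructor exchanges
    field
      swap : ∀ x y → Graph S d x y → Graph T e (select X y x) (select X x y)

  open Exchanges using (swap)

  -- f plus c times the unit vector at u.
  addAt : V → Bool → (V → Bool) → V → Bool
  addAt u c f i = f i + c * δ u i

  -- The entry at u toggled; for a characteristic function, u is added to the set
  -- or removed from it.
  toggleAt : V → (V → Bool) → V → Bool
  toggleAt u f i = f i + δ u i

  Graph-cong : ∀ S d {x x′ y y′} → x ≗ x′ → y ≗ y′ → Graph S d x y → Graph S d x′ y′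
  Graph-cong S d {x} {x′} {y} {y′} p q g i = begin
    y′ i                     ≡⟨ q i ⟨
    y i                      ≡⟨ g i ⟩
    apply S x i + d i * x i  ≡⟨ cong₂ _+_ (apply-cong S p i) (cong (d i *_) (p i)) ⟩
    apply S x′ i + d i * x′ i ∎

  Exchanges-congˣ : ∀ {X X′ S d T e} → X ≗ X′ → Exchanges X S d T e → Exchanges X′ S d T e
  Exchanges-congˣ {T = T} {e = e} p ex = exchanges λ x y g →
    Graph-cong T e (λ i → cong (if_then y i else x i) (p i))
                   (λ i → cong (if_then x i else y i) (p i))
                   (swap ex x y g)

  -- With s = (S x) u, the map x ↦ x + s δ u, y ↦ y + d u s δ u carries the graph of
  -- (S ⋆ u) + diag (d + S u) = (S + diag d) + c cᵀ into that of S + diag d.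
  Graph-localComplement : ∀ S (d : V → Bool) u x y →
    Graph (matrix (S ⋆ u)) (λ i → d i + matrix S u i) x y →
    Graph (matrix S) d (addAt u (apply (matrix S) x u) x) (addAt u (d u * apply (matrix S) x u) y)
  Graph-localComplement S d u x y g i = begin
    y i + d u * s * δ u i
      ≡⟨ cong₂ _+_ (g i) (solve 3 (λ d s e → d :* s :* e := s :* (d :* e)) refl (d u) s (δ u i)) ⟩
    apply (matrix (S ⋆ u)) x i + (d i + c i) * x i + s * (d u * δ u i)
      ≡⟨ cong₂ (λ a b → a + (d i + c i) * x i + s * b)
               (apply-localComplement S u x i) (δ-transport d u i) ⟩
    a + c i * s + c i * x i + (d i + c i) * x i + s * (d i * δ u i)
      ≡⟨ solve 6 (λ a c s x d e → a :+ c :* s :+ c :* x :+ (d :+ c) :* x :+ s :* (d :* e)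
           := a :+ c :* s :+ d :* (x :+ s :* e)) refl a (c i) s (x i) (d i) (δ u i) ⟩
    a + c i * s + d i * (x i + s * δ u i)
      ≡⟨ cong (λ b → a + b * s + d i * (x i + s * δ u i)) (symmetric S u i) ⟩
    a + matrix S i u * s + d i * (x i + s * δ u i)
      ≡⟨ cong (_+ d i * (x i + s * δ u i)) (apply-addAt (matrix S) x s u i) ⟨
    apply (matrix S) (addAt u s x) i + d i * addAt u s x i ∎
    where
    c = matrix S u
    s = apply (matrix S) x u
    a = apply (matrix S) x i

  -- On the graph of (S ⋆ u) + diag (d + S u), the coordinate y u equals s + d u x u.
  -- So at u the map of the previous lemma swaps x u and y u if d u = 1, and sends
  -- (x u , y u) to (x u + y u , y u) if d u = 0.
  Graph-localComplement-at : ∀ S (d : V → Bool) u x y →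
    Graph (matrix (S ⋆ u)) (λ i → d i + matrix S u i) x y →
    y u ≡ apply (matrix S) x u + d u * x u
  Graph-localComplement-at S d u x y g = begin
    y u
      ≡⟨ g u ⟩
    apply (matrix (S ⋆ u)) x u + (d u + c) * x u
      ≡⟨ cong (_+ (d u + c) * x u) (apply-localComplement S u x u) ⟩
    s + c * s + c * x u + (d u + c) * x u
      ≡⟨ cong (λ c → s + c * s + c * x u + (d u + c) * x u) (zeroDiagonal S u) ⟩
    s + 0# * s + 0# * x u + (d u + 0#) * x u
      ≡⟨ solve 3 (λ s x d → s :+ con 0# :* s :+ con 0# :* x :+ (d :+ con 0#) :* x
           := s :+ d :* x) refl s (x u) (d u) ⟩
    s + d u * x u ∎
    where
    c = matrix S u u
    s = apply (matrix S) x u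

  -- The map of Graph-localComplement swaps the coordinates at u, and this
  -- composes with the swap on X to the swap on X toggled at u.
  pivot : ∀ {X T e} S (d : V → Bool) u → d u ≡ 1# → Exchanges X (matrix S) d T e →
    Exchanges (toggleAt u X) (matrix (S ⋆ u)) (λ i → d i + matrix S u i) T e
  pivot {X} {T} {e} S d u du≡1 ex = exchanges swapped
    where
    swapped : ∀ x y → Graph (matrix (S ⋆ u)) (λ i → d i + matrix S u i) x y →
      Graph T e (select (toggleAt u X) y x) (select (toggleAt u X) x y)
    swapped x y g = Graph-cong T e eqˣ eqʸ (swap ex _ _ (Graph-localComplement S d u x y g))
      where
      s = apply (matrix S) x u
      yu : y u ≡ s + x u
      yu = trans (Graph-localComplement-at S d u x y g) (cong (λ b → s + b * x u) du≡1)
      xu : x u ≡ s + y u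
      xu = trans (solve 2 (λ x s → x := s :+ (s :+ x)) refl (x u) s) (cong (s +_) (sym yu))
      ds : d u * s ≡ s
      ds = cong (_* s) du≡1
      eqˣ : select X (addAt u (d u * s) y) (addAt u s x) ≗ select (toggleAt u X) y x
      eqˣ i = trans (cong (λ t → if X i then y i + t * δ u i else x i + s * δ u i) ds)
        (if-toggle (X i) s (condition i))
        where
        condition : ∀ i → δ u i ≡ 0# ⊎ (δ u i ≡ 1# × y i ≡ s + x i)
        condition i with equal-or-δ≡0 u i
        ... | inj₁ refl  = inj₂ (δ-diagonal u , yu)
        ... | inj₂ δui≡0 = inj₁ δui≡0
      eqʸ : select X (addAt u s x) (addAt u (d u * s) y) ≗ select (toggleAt u X) x y
      eqʸ i = trans (cong (λ t → if X i then x i + s * δ u i else y i + t * δ u i) ds)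
        (if-toggle (X i) s (condition i))
        where
        condition : ∀ i → δ u i ≡ 0# ⊎ (δ u i ≡ 1# × x i ≡ s + y i)
        condition i with equal-or-δ≡0 u i
        ... | inj₁ refl  = inj₂ (δ-diagonal u , xu)
        ... | inj₂ δui≡0 = inj₁ δui≡0

  -- The map of Graph-localComplement adds y u to x u.  As u lies in X, after the
  -- swap this adds the input coordinate at u to the output coordinate at u, which
  -- toggles e at u.
  shear : ∀ {X T e} S (d : V → Bool) u → d u ≡ 0# → X u ≡ 1# → Exchanges X (matrix S) d T e →
    Exchanges X (matrix (S ⋆ u)) (λ i → d i + matrix S u i) T (toggleAt u e)
  shear {X} {T} {e} S d u du≡0 Xu≡1 ex = exchanges swapped
    where
    swapped : ∀ x y → Graph (matrix (S ⋆ u)) (λ i → d i + matrix S u i) x y →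
      Graph T (toggleAt u e) (select X y x) (select X x y)
    swapped x y g i = begin
      select X x y i
        ≡⟨ eqʸ ⟩
      select X x′ y i + s * δ u i
        ≡⟨ cong (_+ s * δ u i) (Graph-cong T e (λ j → cong (if X j then_else x′ j) (y′≗y j))
                                           (λ j → cong (if X j then x′ j else_) (y′≗y j))
                                           (swap ex _ _ (Graph-localComplement S d u x y g)) i) ⟩
      apply T (select X y x′) i + e i * select X y x′ i + s * δ u i
        ≡⟨ cong₂ (λ a b → a + e i * b + s * δ u i) (apply-cong T eqˣ i) (eqˣ i) ⟩
      apply T (select X y x) i + e i * select X y x i + s * δ u i
        ≡⟨ cong (λ b → apply T (select X y x) i + e i * select X y x i + b * δ u i)
                (sym (trans (cong (if_then y u else x u) Xu≡1) yu)) ⟩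
      apply T (select X y x) i + e i * select X y x i + select X y x u * δ u i
        ≡⟨ cong (apply T (select X y x) i + e i * select X y x i +_) (δ-transport (select X y x) u i) ⟩
      apply T (select X y x) i + e i * select X y x i + select X y x i * δ u i
        ≡⟨ solve 4 (λ a e z d → a :+ e :* z :+ z :* d := a :+ (e :+ d) :* z) refl
             (apply T (select X y x) i) (e i) (select X y x i) (δ u i) ⟩
      apply T (select X y x) i + (e i + δ u i) * select X y x i ∎
      where
      s = apply (matrix S) x u
      x′ = addAt u s x
      yu : y u ≡ s
      yu = trans (Graph-localComplement-at S d u x y g)
                 (trans (cong (λ b → s + b * x u) du≡0) (GF2.+-identityʳ s))
      y′≗y : addAt u (d u * s) y ≗ y
      y′≗y j = trans (cong (λ b → y j + b * s * δ u j) du≡0) (GF2.+-identityʳ (y j))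
      eqˣ : select X y x′ ≗ select X y x
      eqˣ j = if-addʳ (X j) s (value-or-δ≡0 X Xu≡1 j)
      eqʸ : select X x y i ≡ select X x′ y i + s * δ u i
      eqʸ = if-add-cancelˡ (X i) s (value-or-δ≡0 X Xu≡1 i)

  -- Outside X the swap does nothing, so toggling d and toggling e at v have the
  -- same effect.
  toggleOutside : ∀ {X S T d e} v → X v ≡ 0# → Exchanges X S d T e →
    Exchanges X S (toggleAt v d) T (toggleAt v e)
  toggleOutside {X} {S} {T} {d} {e} v Xv≡0 ex = exchanges swapped
    where
    swapped : ∀ x y → Graph S (toggleAt v d) x y →
      Graph T (toggleAt v e) (select X y x) (select X x y)
    swapped x y g i = begin
      select X x y i
        ≡⟨ eqʸ ⟩
      select X x y′ i + x v * δ v i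
        ≡⟨ cong (_+ x v * δ v i) (swap ex x y′ g′ i) ⟩
      apply T (select X y′ x) i + e i * select X y′ x i + x v * δ v i
        ≡⟨ cong₂ (λ a b → a + e i * b + x v * δ v i) (apply-cong T eqˣ i) (eqˣ i) ⟩
      apply T (select X y x) i + e i * select X y x i + x v * δ v i
        ≡⟨ cong (λ b → apply T (select X y x) i + e i * select X y x i + b * δ v i)
                (sym (cong (if_then y v else x v) Xv≡0)) ⟩
      apply T (select X y x) i + e i * select X y x i + select X y x v * δ v i
        ≡⟨ cong (apply T (select X y x) i + e i * select X y x i +_) (δ-transport (select X y x) v i) ⟩
      apply T (select X y x) i + e i * select X y x i + select X y x i * δ v i
        ≡⟨ solve 4 (λ a e z d → a :+ e :* z :+ z :* d := a :+ (e :+ d) :* z) refl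
             (apply T (select X y x) i) (e i) (select X y x i) (δ v i) ⟩
      apply T (select X y x) i + (e i + δ v i) * select X y x i ∎
      where
      y′ = addAt v (x v) y
      g′ : Graph S d x y′
      g′ j = begin
        y j + x v * δ v j
          ≡⟨ cong₂ _+_ (g j) (δ-transport x v j) ⟩
        apply S x j + (d j + δ v j) * x j + x j * δ v j
          ≡⟨ solve 4 (λ a d e x → a :+ (d :+ e) :* x :+ x :* e := a :+ d :* x) refl
             (apply S x j) (d j) (δ v j) (x j) ⟩
        apply S x j + d j * x j ∎
      eqˣ : select X y′ x ≗ select X y x
      eqˣ j = if-addˡ (X j) (x v) (value-or-δ≡0 X Xv≡0 j)
      eqʸ : select X x y i ≡ select X x y′ i + x v * δ v i
      eqʸ = if-add-cancelʳ (X i) (x v) (value-or-δ≡0 X Xv≡0 i)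

  -- Well-founded induction on sets of indices

  -- The set with characteristic function X, transported to Fin n.
  support : (V → Bool) → Subset n
  support X = tabulate (X ∘ from)

  -- Strict inclusion of sets given by characteristic functions.
  infix 4 _≺_
  _≺_ : Rel (V → Bool) _
  _≺_ = _⊂_ on support

  ≺-wellFounded : WellFounded _≺_
  ≺-wellFounded = On.wellFounded support ⊂-wellFounded

  ≺-intro : ∀ X Y v → (∀ w → X w ≡ 1# → Y w ≡ 1#) → Y v ≡ 1# → X v ≡ 0# → X ≺ Y
  ≺-intro X Y v X⊆Y Yv≡1 Xv≡0 =
      (λ {k} k∈X → lookup⇒[]= k (support Y) (trans (lookup∘tabulate (Y ∘ from) k)
        (X⊆Y (from k) (trans (sym (lookup∘tabulate (X ∘ from) k)) ([]=⇒lookup k∈X)))))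
    , to v
    , lookup⇒[]= (to v) (support Y) (trans (lookup-to Y) Yv≡1)
    , λ v∈X → 0≢1 Xv≡0 (trans (sym (lookup-to X)) ([]=⇒lookup v∈X))
    where
    lookup-to : ∀ Z → lookup (support Z) (to v) ≡ Z v
    lookup-to Z = trans (lookup∘tabulate (Z ∘ from) (to v)) (cong Z (strictlyInverseʳ v))

  toggleAt-at : ∀ X v → toggleAt v X v ≡ not (X v)
  toggleAt-at X v = trans (cong (X v +_) (δ-diagonal v)) (Bool.xor-comm (X v) 1#)

  toggleAt-⊆ : ∀ X v → X v ≡ 1# → ∀ w → toggleAt v X w ≡ 1# → X w ≡ 1#
  toggleAt-⊆ X v Xv≡1 w p with to v Fin.≟ to w
  ... | yes q with refl ← to-injective q = Xv≡1
  ... | no _ = trans (sym (GF2.+-identityʳ (X w))) p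

  toggleAt-⊇ : ∀ X v → X v ≡ 0# → ∀ w → X w ≡ 1# → toggleAt v X w ≡ 1#
  toggleAt-⊇ X v Xv≡0 w p with to v Fin.≟ to w
  ... | yes q with refl ← to-injective q = contradiction p (0≢1 Xv≡0)
  ... | no _ = trans (GF2.+-identityʳ (X w)) p

  toggleAt-≺ : ∀ X v → X v ≡ 1# → toggleAt v X ≺ X
  toggleAt-≺ X v Xv≡1 =
    ≺-intro (toggleAt v X) X v (toggleAt-⊆ X v Xv≡1) Xv≡1 (trans (toggleAt-at X v) (cong not Xv≡1))

  toggleAt-≻ : ∀ X v → X v ≡ 0# → not ∘ toggleAt v X ≺ not ∘ X
  toggleAt-≻ X v Xv≡0 = ≺-intro (not ∘ toggleAt v X) (not ∘ X) v
    (λ w p → cong not (Bool.¬-not λ Xw≡1 →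
      contradiction (toggleAt-⊇ X v Xv≡0 w Xw≡1) (0≢1 (Bool.not-injective p))))
    (cong not Xv≡0)
    (cong not (trans (toggleAt-at X v) (cong not Xv≡0)))

  -- From exchanges to local complementations

  -- An exchange at no index means that S + diag d = T + diag e.
  Exchanges-∅ : ∀ S d T e → Exchanges (const 0#) (matrix S) d (matrix T) e → matrix S ≐ matrix T
  Exchanges-∅ S d T e ex i j with to i Fin.≟ to j
  ... | yes p with refl ← to-injective p = trans (zeroDiagonal S i) (sym (zeroDiagonal T i))
  ... | no i≢j = begin
    matrix S i j                          ≡⟨ column S d ⟨
    apply (matrix S) (δ j) i + d i * δ j i ≡⟨ swap ex (δ j) _ (λ _ → refl) i ⟩
    apply (matrix T) (δ j) i + e i * δ j i ≡⟨ column T e ⟩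
    matrix T i j                          ∎
    where
    column : ∀ (U : ZeroDiagonalSymmetric V) (f : V → Bool) →
      apply (matrix U) (δ j) i + f i * δ j i ≡ matrix U i j
    column U f = begin
      apply (matrix U) (δ j) i + f i * δ j i
        ≡⟨ cong₂ _+_ (apply-δ (matrix U) j i)
                     (cong (f i *_) (δ-offDiagonal (λ j≡i → i≢j (cong to (sym j≡i))))) ⟩
      matrix U i j + f i * 0#
        ≡⟨ solve 2 (λ u f → u :+ f :* con 0# := u) refl (matrix U i j) (f i) ⟩
      matrix U i j ∎

  -- If d vanishes on X, then each v in X has a neighbour u in X.  Otherwise the
  -- unit vector at v has an image vanishing on X, so the swap turns it into a
  -- point of the graph of T + diag e with zero input and nonzero output at v.
  exchange-neighbour : ∀ {X S d T e v} → Exchanges X S d T e → X v ≡ 1# →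
    (∀ u → X u * d u ≡ 0#) → ∃[ u ] X u * S u v ≡ 1#
  exchange-neighbour {X} {S} {d} {T} {e} {v} ex Xv≡1 Xd≡0 with search (λ u → X u * S u v)
  ... | inj₁ found = found
  ... | inj₂ XS≡0 = contradiction 1≡0 (λ ())
    where
    y : V → Bool
    y i = apply S (δ v) i + d i * δ v i
    x′≡0 : ∀ i → select X y (δ v) i ≡ 0#
    x′≡0 i with X i in Xi | XS≡0 i | Xd≡0 i
    ... | true  | Siv≡0 | di≡0 =
          cong₂ (λ a b → a + b * δ v i) (trans (apply-δ S v i) Siv≡0) di≡0
    ... | false | _ | _ = δ-offDiagonal (λ v≡i → 0≢1 Xi (subst (λ w → X w ≡ 1#) v≡i Xv≡1))
    1≡0 : 1# ≡ 0#
    1≡0 = begin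
      1#                     ≡⟨ δ-diagonal v ⟨
      δ v v                  ≡⟨ cong (if_then δ v v else y v) Xv≡1 ⟨
      select X (δ v) y v     ≡⟨ swap ex (δ v) y (λ _ → refl) v ⟩
      apply T (select X y (δ v)) v + e v * select X y (δ v) v
        ≡⟨ cong₂ _+_ (∑-cong (λ k → trans (cong (T v k *_) (x′≡0 k)) (GF2.zeroʳ (T v k))))
                     (trans (cong (e v *_) (x′≡0 v)) (GF2.zeroʳ (e v))) ⟩
      Σⱽ (λ _ → 0#) + 0#     ≡⟨ cong (_+ 0#) (sum-zero (λ (_ : Fin n) → 0#) (λ _ → refl)) ⟩
      0#                     ∎

  LC-cons : ∀ S u T → LCEquivalent V↔Fin (S ⋆ u) T → LCEquivalent V↔Fin S T
  LC-cons S u T (U , p , U≐T) = U , (u , λ _ _ → refl) ◅ p , U≐T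

  -- Each round removes an index v from X by pivoting at v.  If no v in X has
  -- d v = 1, a shear at a neighbour u in X first makes d v = 1; it leaves X alone.
  exchanges⇒LC : ∀ {X} → Acc _≺_ X → ∀ S d T e →
    Exchanges X (matrix S) d (matrix T) e → LCEquivalent V↔Fin S T
  exchanges⇒LC {X} (acc rec) S d T e ex with search (λ v → X v * d v)
  ... | inj₁ (v , Xdv≡1) = LC-cons S v T
        (exchanges⇒LC (rec (toggleAt-≺ X v (*≡1⇒ˡ Xdv≡1))) (S ⋆ v) _ T e
          (pivot S d v (*≡1⇒ʳ {X v} Xdv≡1) ex))
  ... | inj₂ Xd≡0 with search X
  ...   | inj₂ X≡0 = S , ε , Exchanges-∅ S d T e (Exchanges-congˣ X≡0 ex)
  ...   | inj₁ (v , Xv≡1) with exchange-neighbour ex Xv≡1 Xd≡0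
  ...     | u , XSu≡1 = LC-cons S u T (LC-cons (S ⋆ u) v T
        (exchanges⇒LC (rec (toggleAt-≺ X v Xv≡1)) (S ⋆ u ⋆ v) _ T (toggleAt u e)
          (pivot (S ⋆ u) d′ v d′v≡1 (shear S d u du≡0 (*≡1⇒ˡ XSu≡1) ex))))
    where
    zeroOn : ∀ {w} → X w ≡ 1# → d w ≡ 0#
    zeroOn {w} Xw≡1 = trans (cong (_* d w) (sym Xw≡1)) (Xd≡0 w)
    du≡0 : d u ≡ 0#
    du≡0 = zeroOn (*≡1⇒ˡ XSu≡1)
    d′ : V → Bool
    d′ i = d i + matrix S u i
    d′v≡1 : d′ v ≡ 1#
    d′v≡1 = cong₂ _+_ (zeroOn Xv≡1) (*≡1⇒ʳ {X u} XSu≡1)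

  -- Modified inverses as exchanges at every index

  -- The witness e is the diagonal of the inverse, so that T + diag e is the inverse.
  modifiedInverse⇒exchanges : ∀ S T → IsModifiedInverse V↔Fin S T →
    ∃[ d ] ∃[ e ] Exchanges (const 1#) (matrix S) d (matrix T) e
  modifiedInverse⇒exchanges S T (d , B , (_ , BA≐I) , T≐B) = d , (λ i → B i i) , exchanges swapped
    where
    A = toggleDiagonal V↔Fin d (matrix S)
    swapped : ∀ x y → Graph (matrix S) d x y → Graph (matrix T) (λ i → B i i) y x
    swapped x y g i = begin
      x i
        ≡⟨ ∑-δ i x ⟨
      apply δ x i
        ≡⟨ ∑-cong (λ k → cong (_* x k) (BA≐I i k)) ⟨
      apply (product V↔Fin B A) x i
        ≡⟨ apply-product B A x i ⟨
      apply B (apply A x) i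
        ≡⟨ apply-cong B (λ k → trans (apply-toggleDiagonal d (matrix S) x k) (sym (g k))) i ⟩
      apply B y i
        ≡⟨ solve 2 (λ a b → a := a :+ b :+ b) refl (apply B y i) (B i i * y i) ⟩
      apply B y i + B i i * y i + B i i * y i
        ≡⟨ cong (_+ B i i * y i) (apply-toggleDiagonal (λ i → B i i) B y i) ⟨
      apply (toggleNonzeroDiagonal V↔Fin B) y i + B i i * y i
        ≡⟨ cong (_+ B i i * y i) (∑-cong (λ k → cong (_* y k) (T≐B i k))) ⟨
      apply (matrix T) y i + B i i * y i ∎

  product-transpose : ∀ {A B} → IsSymmetric A → IsSymmetric B → ∀ i j →
    product V↔Fin A B i j ≡ product V↔Fin B A j i
  product-transpose {A} {B} A-sym B-sym i j =
    ∑-cong (λ k → trans (GF2.*-comm (A i k) (B k j)) (cong₂ _*_ (B-sym k j) (A-sym i k)))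

  exchanges⇒inverse : ∀ S d T e → Exchanges (const 1#) (matrix S) d (matrix T) e →
    IsInverse V↔Fin (toggleDiagonal V↔Fin d (matrix S)) (toggleDiagonal V↔Fin e (matrix T))
  exchanges⇒inverse S d T e ex = AB≐I , BA≐I
    where
    A = toggleDiagonal V↔Fin d (matrix S)
    B = toggleDiagonal V↔Fin e (matrix T)
    BA≐I : product V↔Fin B A ≐ δ
    BA≐I i j = begin
      apply B (λ k → A k j) i
        ≡⟨ apply-toggleDiagonal e (matrix T) (λ k → A k j) i ⟩
      apply (matrix T) (λ k → A k j) i + e i * A i j
        ≡⟨ swap ex (δ j) (λ k → A k j)
             (λ k → trans (sym (apply-δ A j k)) (apply-toggleDiagonal d (matrix S) (δ j) k)) i ⟨
      δ j i
        ≡⟨ δ-comm j i ⟩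
      δ i j ∎
    -- A and B are symmetric, so AB is the transpose of BA.
    AB≐I : product V↔Fin A B ≐ δ
    AB≐I i j = begin
      product V↔Fin A B i j
        ≡⟨ product-transpose (toggleDiagonal-symmetric d (symmetric S))
                             (toggleDiagonal-symmetric e (symmetric T)) i j ⟩
      product V↔Fin B A j i   ≡⟨ BA≐I j i ⟩
      δ j i                   ≡⟨ δ-comm j i ⟩
      δ i j                   ∎

  exchanges⇒modifiedInverse : ∀ S d T e → Exchanges (const 1#) (matrix S) d (matrix T) e →
    IsModifiedInverse V↔Fin S T
  exchanges⇒modifiedInverse S d T e ex =
    d , B , exchanges⇒inverse S d T e ex , λ i j → sym (clear i j)
    where
    B = toggleDiagonal V↔Fin e (matrix T)
    B-diagonal : ∀ i → B i i ≡ e i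
    B-diagonal i = begin
      B i i                        ≡⟨ toggleDiagonal-δ e (matrix T) i i ⟩
      matrix T i i + e i * δ i i   ≡⟨ cong₂ (λ t b → t + e i * b) (zeroDiagonal T i) (δ-diagonal i) ⟩
      e i * 1#                     ≡⟨ GF2.*-identityʳ (e i) ⟩
      e i                          ∎
    clear : toggleNonzeroDiagonal V↔Fin B ≐ matrix T
    clear i j = begin
      toggleNonzeroDiagonal V↔Fin B i j
        ≡⟨ toggleDiagonal-δ (λ i → B i i) B i j ⟩
      B i j + B i i * δ i j
        ≡⟨ cong₂ (λ a b → a + b * δ i j) (toggleDiagonal-δ e (matrix T) i j) (B-diagonal i) ⟩
      matrix T i j + e i * δ i j + e i * δ i j
        ≡⟨ solve 2 (λ t b → t :+ b :+ b := t) refl (matrix T i j) (e i * δ i j) ⟩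
      matrix T i j ∎

  -- Here A B = 1 is used, whereas the given exchange expresses B A = 1.
  Exchanges-sym : ∀ S d T e → Exchanges (const 1#) (matrix S) d (matrix T) e →
    Exchanges (const 1#) (matrix T) e (matrix S) d
  Exchanges-sym S d T e ex = exchanges swapped
    where
    swapped : ∀ x y → Graph (matrix T) e x y → Graph (matrix S) d y x
    swapped x y g i = begin
      x i
        ≡⟨ ∑-δ i x ⟨
      apply δ x i
        ≡⟨ ∑-cong (λ k → cong (_* x k) (proj₁ (exchanges⇒inverse S d T e ex) i k)) ⟨
      apply (product V↔Fin A B) x i
        ≡⟨ apply-product A B x i ⟨
      apply A (apply B x) i
        ≡⟨ apply-cong A (λ k → trans (apply-toggleDiagonal e (matrix T) x k) (sym (g k))) i ⟩
      apply A y i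
        ≡⟨ apply-toggleDiagonal d (matrix S) y i ⟩
      apply (matrix S) y i + d i * y i ∎
      where
      A = toggleDiagonal V↔Fin d (matrix S)
      B = toggleDiagonal V↔Fin e (matrix T)

  -- From local complementations to modified inverses

  -- An exchange at X can be extended to all indices by pivoting at the indices
  -- outside X.  The diagonal e changes only at these indices.
  complete : ∀ {X} → Acc _≺_ (not ∘ X) → ∀ U d T e → Exchanges X (matrix U) d T e →
    ∃[ U′ ] ∃[ d′ ] ∃[ e′ ] Exchanges (const 1#) (matrix U′) d′ T e′
                          × (∀ v → X v ≡ 1# → e′ v ≡ e v)
  complete {X} (acc rec) U d T e ex with search (not ∘ X)
  ... | inj₂ full = U , d , e , Exchanges-congˣ (λ v → Bool.not-injective (full v)) ex , λ _ _ → refl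
  ... | inj₁ (v , ¬Xv) with Xv≡0 ← Bool.not-injective {X v} {0#} ¬Xv with d v Bool.≟ 1#
  ...   | yes dv≡1 =
          let ex₁ = pivot U d v dv≡1 ex
              U′ , d′ , e′ , ex′ , agree = complete (rec (toggleAt-≻ X v Xv≡0)) (U ⋆ v) _ T e ex₁
          in U′ , d′ , e′ , ex′ , λ w Xw≡1 → agree w (toggleAt-⊇ X v Xv≡0 w Xw≡1)
  ...   | no dv≢1 =
          let e₁ = toggleAt v e
              d₁v≡1 = trans (toggleAt-at d v) (cong not (Bool.¬-not dv≢1))
              ex₁ = pivot U (toggleAt v d) v d₁v≡1 (toggleOutside v Xv≡0 ex)
              U′ , d′ , e′ , ex′ , agree = complete (rec (toggleAt-≻ X v Xv≡0)) (U ⋆ v) _ T e₁ ex₁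
          in U′ , d′ , e′ , ex′ , λ w Xw≡1 →
               trans (agree w (toggleAt-⊇ X v Xv≡0 w Xw≡1)) (unchanged w Xw≡1)
    where
    unchanged : ∀ w → X w ≡ 1# → toggleAt v e w ≡ e w
    unchanged w Xw≡1 = trans (cong (e w +_) (δ-offDiagonal λ { refl → 0≢1 Xv≡0 Xw≡1 }))
                             (GF2.+-identityʳ (e w))

  -- In terms of matrices: if i is not isolated in S, then S + diag e is invertible
  -- for some e with e i = 0.
  nonisolated⇒exchange : ∀ S {i j} → matrix S j i ≡ 1# →
    ∃[ U ] ∃[ d ] ∃[ e ] Exchanges (const 1#) (matrix U) d (matrix S) e × e i ≡ 0#
  nonisolated⇒exchange S {i} {j} Sji≡1 =
    let U , d , e , ex , agree = complete (≺-wellFounded (not ∘ X₂)) (S ⋆ j ⋆ i) _ (matrix S) e₀ ex₂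
    in U , d , e , ex , trans (agree i X₂i≡1) (cong (0# +_) δji≡0)
    where
    -- Pivoting at j, then at i, starting from the trivial exchange at no index.
    X₁ X₂ d₁ e₀ : V → Bool
    X₁ = toggleAt j (const 0#)
    X₂ = toggleAt i X₁
    e₀ = toggleAt j (const 0#)
    d₁ k = toggleAt j (const 0#) k + matrix S j k
    δji≡0 : δ j i ≡ 0#
    δji≡0 = δ-offDiagonal λ { refl → 0≢1 (zeroDiagonal S i) Sji≡1 }
    ex₁ : Exchanges X₁ (matrix (S ⋆ j)) d₁ (matrix S) e₀
    ex₁ = pivot S (toggleAt j (const 0#)) j (toggleAt-at (const 0#) j)
            (toggleOutside {d = const 0#} {e = const 0#} j refl (exchanges λ x y g → g))
    -- The pivot at j has set the diagonal entry at i to S j i = 1.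
    ex₂ : Exchanges X₂ (matrix (S ⋆ j ⋆ i)) (λ k → d₁ k + matrix (S ⋆ j) i k) (matrix S) e₀
    ex₂ = pivot (S ⋆ j) d₁ i (cong₂ _+_ δji≡0 Sji≡1) ex₁
    X₂i≡1 : X₂ i ≡ 1#
    X₂i≡1 = trans (toggleAt-at X₁ i) (cong not δji≡0)

  localComplement⇒MI : ∀ S i → MIEquivalent V↔Fin S (S ⋆ i)
  localComplement⇒MI S i with search (matrix S i)
  ... | inj₂ isolated = S , ε , λ j k → sym (begin
          matrix (S ⋆ i) j k
            ≡⟨ localComplement-rankOne S i j k ⟩
          matrix S j k + matrix S i j * matrix S i k + matrix S i j * δ j k
            ≡⟨ cong (λ b → matrix S j k + b * matrix S i k + b * δ j k) (isolated j) ⟩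
          matrix S j k + 0# + 0#
            ≡⟨ solve 1 (λ s → s :+ con 0# :+ con 0# := s) refl (matrix S j k) ⟩
          matrix S j k ∎)
  ... | inj₁ (j , Sij≡1) =
      -- S + diag e is inverse to U + diag d, and the shear at i makes S ⋆ i with a
      -- suitable diagonal inverse to U + diag d toggled at i.
      let U , d , e , ex , ei≡0 = nonisolated⇒exchange S (trans (symmetric S j i) Sij≡1)
          e′ k = e k + matrix S i k
          ex-S⋆i = shear S e i ei≡0 refl (Exchanges-sym U d S e ex)
          S→U = exchanges⇒modifiedInverse S e U d (Exchanges-sym U d S e ex)
          U→S⋆i = exchanges⇒modifiedInverse U (toggleAt i d) (S ⋆ i) e′
                    (Exchanges-sym (S ⋆ i) e′ U (toggleAt i d) ex-S⋆i)
      in S ⋆ i , _◅_ {j = U} S→U (U→S⋆i ◅ ε) , λ _ _ → refl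

  -- Compatibility with entrywise equality

  LC-respectsLeft : RespectsLeft (IsLocalComplement V↔Fin)
  LC-respectsLeft S S′ T S′≐S (i , T≐) =
    i , ≐-trans T≐ (λ j k → sym (localComplement-cong {S′} {S} S′≐S i j k))

  MI-respectsLeft : RespectsLeft (IsModifiedInverse V↔Fin)
  MI-respectsLeft S S′ T S′≐S (D , B , (AB≐I , BA≐I) , T≐) =
    D , B , ( ≐-trans {B = product V↔Fin A B} (product-cong A′ A B B A′≐A (λ _ _ → refl)) AB≐I
            , ≐-trans {B = product V↔Fin B A} (product-cong B B A′ A (λ _ _ → refl) A′≐A) BA≐I) , T≐
    where
    A  = toggleDiagonal V↔Fin D (matrix S)
    A′ = toggleDiagonal V↔Fin D (matrix S′)
    A′≐A : A′ ≐ A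
    A′≐A = toggleDiagonal-cong D (matrix S′) (matrix S) S′≐S

theorem13 : {ℓ : Level} {V : Set ℓ} {n : ℕ} (V↔Fin : V ↔ Fin n) →
    (S T : ZeroDiagonalSymmetric V) →
    LCEquivalent V↔Fin S T ⇔ MIEquivalent V↔Fin S T
theorem13 V↔Fin S T = mk⇔
  (reachable-map (IsLocalComplement V↔Fin) (IsModifiedInverse V↔Fin) (MI-respectsLeft V↔Fin)
    (λ S T (i , T≐S⋆i) →
      let U , p , U≐S⋆i = localComplement⇒MI V↔Fin S i
      in U , p , λ j k → trans (U≐S⋆i j k) (sym (T≐S⋆i j k)))
    S T)
  (reachable-map (IsModifiedInverse V↔Fin) (IsLocalComplement V↔Fin) (LC-respectsLeft V↔Fin)
    (λ S T m →
      let d , e , ex = modifiedInverse⇒exchanges V↔Fin S T m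
      in exchanges⇒LC V↔Fin (≺-wellFounded V↔Fin (const 1#)) S d T e ex)
    S T)
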